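{- Let $a,b\in\mathbb{Q}^*$ be multiplicatively independent. Then the set of primes $p$ with $\operatorname{ord}_p(a)=\operatorname{ord}_p(b)=0$ such that $(b \bmod p)$ lies in the subgroup $\langle a \bmod p\rangle$ of $\mathbb{F}_p^*$ is infinite.
   Context: Elements $a,b\in\mathbb{Q}^*$ are multiplicatively independent if there are no integers $x,y$, not both zero, with $a^xb^y=1$. For a prime $p$ and $x\in\mathbb{Q}^*$, $\operatorname{ord}_p(x)$ denotes the exponent of $p$ in $x$; when $\operatorname{ord}_p(x)=0$, $x \bmod p$ denotes the reduction of $x$ in $\mathbb{F}_p^*$. -}

module Defs where

open import Algebra.Bundles using (Group; CommutativeRing)
import Algebra.Definitions.RawMonoid as RawMonoidDefs
import Algebra.Definitions.RawSemiring as RawSemiringDefs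
open import Data.Integer as ℤ using (ℤ; +_; -[1+_]; 0ℤ; 1ℤ; ∣_∣)
import Data.Integer.Properties as ℤₚ
import Data.Integer.Divisibility.Signed as ℤ∣
open import Data.Integer.Tactic.RingSolver using (solve-∀)
open import Data.List.Base using (List)
open import Data.List.Membership.Propositional using (_∉_)
open import Data.Nat as ℕ using (ℕ; zero; suc)
open import Data.Nat.Coprimality using (Coprime; coprime⇒GCD≡1; recompute)
open import Data.Nat.Divisibility using (_∣_; _∤_; _∣?_; ∣-reflexive; ∣-trans; m∣m*n)
open import Data.Nat.GCD using (module Bézout)
open import Data.Nat.Primality using (Prime; prime⇒irreducible; ¬prime[1])
import Data.Nat.Properties as ℕₚ
open import Data.Product using (_×_; _,_; proj₁; proj₂; ∃; ∃₂; ∃-syntax; Σ-syntax)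
open import Data.Rational as ℚ using (ℚ; 1ℚ; ↥_; ↧_; ↧ₙ_)
open import Data.Sum using (inj₁; inj₂)
open import Level using (Level; _⊔_; 0ℓ)
open import Relation.Binary.PropositionalEquality
  using (_≡_; _≢_; refl; sym; trans; cong; subst; module ≡-Reasoning)
open import Relation.Nullary using (¬_; yes; no; contradiction)
open import Relation.Unary using (Pred; _∈_)

private variable
  a c ℓ : Level

-- Every finite list of elements omits some element of P: the positive form
-- of "P is not finite".
Infinite : {A : Set a} → Pred A ℓ → Set (a ⊔ ℓ)
Infinite {A = A} P = (xs : List A) → ∃[ x ] x ∈ P × x ∉ xs

open RawSemiringDefs ℚ.+-*-rawSemiring using () renaming (_^_ to _^ℕ_)

infixr 8 _^_
_^_ : (q : ℚ) → ℤ → .{{_ : ℚ.NonZero q}} → ℚ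
q ^ (+ n)    = q ^ℕ n
q ^ -[1+ n ] = (ℚ.1/ q) ^ℕ suc n

MultiplicativelyIndependent :
  (a b : ℚ) → .{{_ : ℚ.NonZero a}} → .{{_ : ℚ.NonZero b}} → Set
MultiplicativelyIndependent a b =
  ¬ (∃₂ λ (x y : ℤ) → ¬ (x ≡ 0ℤ × y ≡ 0ℤ) × (a ^ x) ℚ.* (b ^ y) ≡ 1ℚ)

module _ (G : Group c ℓ) where
  open Group G
  open RawMonoidDefs rawMonoid using () renaming (_×_ to _times_)

  power : Carrier → ℤ → Carrier
  power g (+ n)    = n times g
  power g -[1+ n ] = (suc n times g) ⁻¹

  CyclicSubgroup : Carrier → Pred Carrier ℓ
  CyclicSubgroup g h = ∃[ k ] h ≈ power g k

module _ (R : CommutativeRing c ℓ) where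
  private module R = CommutativeRing R
  open R hiding (zero; refl; sym; trans)
  open import Relation.Binary.Reasoning.Setoid setoid

  record Unit : Set (c ⊔ ℓ) where
    field
      value   : Carrier
      inverse : Carrier
      isInv   : value * inverse ≈ 1#

  open Unit

  private
    interchange : ∀ x y z w → (x * y) * (z * w) ≈ (x * z) * (y * w)
    interchange x y z w = begin
      (x * y) * (z * w) ≈⟨ *-assoc x y (z * w) ⟩
      x * (y * (z * w)) ≈⟨ *-congˡ (*-assoc y z w) ⟨
      x * ((y * z) * w) ≈⟨ *-congˡ (*-congʳ (*-comm y z)) ⟩
      x * ((z * y) * w) ≈⟨ *-congˡ (*-assoc z y w) ⟩
      x * (z * (y * w)) ≈⟨ *-assoc x z (y * w) ⟨
      (x * z) * (y * w) ∎

    inverse-cong : ∀ u v → value u ≈ value v → inverse u ≈ inverse v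
    inverse-cong u v u≈v = begin
      inverse u                           ≈⟨ *-identityʳ _ ⟨
      inverse u * 1#                      ≈⟨ *-congˡ (isInv v) ⟨
      inverse u * (value v * inverse v)   ≈⟨ *-assoc _ _ _ ⟨
      (inverse u * value v) * inverse v   ≈⟨ *-congʳ (*-congˡ u≈v) ⟨
      (inverse u * value u) * inverse v   ≈⟨ *-congʳ (*-comm _ _) ⟩
      (value u * inverse u) * inverse v   ≈⟨ *-congʳ (isInv u) ⟩
      1# * inverse v                      ≈⟨ *-identityˡ _ ⟩
      inverse v                           ∎

  unitGroup : Group (c ⊔ ℓ) ℓ
  unitGroup = record
    { Carrier = Unit
    ; _≈_     = λ u v → value u ≈ value v
    ; _∙_     = λ u v → record
      { value   = value u * value v
      ; inverse = inverse u * inverse v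
      ; isInv   = R.trans (interchange _ _ _ _)
                    (R.trans (*-cong (isInv u) (isInv v)) (*-identityˡ 1#))
      }
    ; ε       = record { value = 1# ; inverse = 1# ; isInv = *-identityˡ 1# }
    ; _⁻¹     = λ u → record
      { value   = inverse u
      ; inverse = value u
      ; isInv   = R.trans (*-comm _ _) (isInv u)
      }
    ; isGroup = record
      { isMonoid = record
        { isSemigroup = record
          { isMagma = record
            { isEquivalence = record { refl = R.refl ; sym = R.sym ; trans = R.trans }
            ; ∙-cong        = *-cong
            }
          ; assoc = λ u v w → *-assoc _ _ _
          }
        ; identity = (λ u → *-identityˡ _) , (λ u → *-identityʳ _)
        }
      ; inverse = (λ u → R.trans (*-comm _ _) (isInv u)) , isInv
      ; ⁻¹-cong = λ {u} {v} → inverse-cong u v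
      }
    }

-- ℤ/nℤ as a setoid quotient: integers, with equality being congruence mod n.
module _ (n : ℕ) where
  infix 4 _≈ₙ_
  _≈ₙ_ : ℤ → ℤ → Set
  x ≈ₙ y = + n ℤ∣.∣ x ℤ.- y

  private
    n∣_via_ : ∀ {x y} → + n ℤ∣.∣ x → x ≡ y → + n ℤ∣.∣ y
    n∣ d via eq = subst (+ n ℤ∣.∣_) eq d

    ≡⇒≈ : ∀ {x y} → x ≡ y → x ≈ₙ y
    ≡⇒≈ {x} refl = subst (+ n ℤ∣.∣_) (sym (ℤₚ.+-inverseʳ x)) (ℤ∣.divides 0ℤ refl)

    neg-diff : ∀ x y → ℤ.- (x ℤ.- y) ≡ y ℤ.- x
    neg-diff = solve-∀

    sum-diff : ∀ x y z → (x ℤ.- y) ℤ.+ (y ℤ.- z) ≡ x ℤ.- z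
    sum-diff = solve-∀

    +-diff : ∀ x y u v → (x ℤ.- y) ℤ.+ (u ℤ.- v) ≡ (x ℤ.+ u) ℤ.- (y ℤ.+ v)
    +-diff = solve-∀

    *-diff : ∀ x y u v → (x ℤ.- y) ℤ.* u ℤ.+ (u ℤ.- v) ℤ.* y ≡ x ℤ.* u ℤ.- y ℤ.* v
    *-diff = solve-∀

    -‿diff : ∀ x y → ℤ.- (x ℤ.- y) ≡ (ℤ.- x) ℤ.- (ℤ.- y)
    -‿diff = solve-∀

  integersMod : CommutativeRing 0ℓ 0ℓ
  integersMod = record
    { Carrier = ℤ
    ; _≈_     = _≈ₙ_
    ; _+_     = ℤ._+_
    ; _*_     = ℤ._*_
    ; -_      = ℤ.-_
    ; 0#      = 0ℤ
    ; 1#      = 1ℤ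
    ; isCommutativeRing = record
      { isRing = record
        { +-isAbelianGroup = record
          { isGroup = record
            { isMonoid = record
              { isSemigroup = record
                { isMagma = record
                  { isEquivalence = record
                    { refl  = λ {x} → ≡⇒≈ {x} refl
                    ; sym   = λ {x} {y} d → n∣ ℤ∣.∣m⇒∣-m d via neg-diff x y
                    ; trans = λ {x} {y} {z} d e →
                        n∣ ℤ∣.∣m∣n⇒∣m+n d e via sum-diff x y z
                    }
                  ; ∙-cong = λ {x} {y} {u} {v} d e →
                      n∣ ℤ∣.∣m∣n⇒∣m+n d e via +-diff x y u v
                  }
                ; assoc = λ x y z → ≡⇒≈ (ℤₚ.+-assoc x y z)
                }
              ; identity = (λ x → ≡⇒≈ (ℤₚ.+-identityˡ x)) , (λ x → ≡⇒≈ (ℤₚ.+-identityʳ x))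
              }
            ; inverse = (λ x → ≡⇒≈ (ℤₚ.+-inverseˡ x)) , (λ x → ≡⇒≈ (ℤₚ.+-inverseʳ x))
            ; ⁻¹-cong = λ {x} {y} d → n∣ ℤ∣.∣m⇒∣-m d via -‿diff x y
            }
          ; comm = λ x y → ≡⇒≈ (ℤₚ.+-comm x y)
          }
        ; *-cong = λ {x} {y} {u} {v} d e →
            n∣ ℤ∣.∣m∣n⇒∣m+n (ℤ∣.∣m⇒∣m*n u d) (ℤ∣.∣m⇒∣m*n y e) via *-diff x y u v
        ; *-assoc = λ x y z → ≡⇒≈ (ℤₚ.*-assoc x y z)
        ; *-identity = (λ x → ≡⇒≈ (ℤₚ.*-identityˡ x)) , (λ x → ≡⇒≈ (ℤₚ.*-identityʳ x))
        ; distrib = (λ x y z → ≡⇒≈ (ℤₚ.*-distribˡ-+ x y z))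
                  , (λ x y z → ≡⇒≈ (ℤₚ.*-distribʳ-+ x y z))
        }
      ; *-comm = λ x y → ≡⇒≈ (ℤₚ.*-comm x y)
      }
    }

𝔽* : ℕ → Group 0ℓ 0ℓ
𝔽* p = unitGroup (integersMod p)

-- The largest e ≤ bound with p ^ e ∣ n.
largestExponent : (p n bound : ℕ) → ℕ
largestExponent p n zero    = 0
largestExponent p n (suc e) with p ℕ.^ suc e ∣? n
... | yes _ = suc e
... | no  _ = largestExponent p n e

-- For p ≥ 2 and n ≥ 1, p ^ e ∣ n forces e < p ^ e ≤ n, so n bounds the search.
ordℕ : (p n : ℕ) → ℕ
ordℕ p n = largestExponent p n n

ord : (p : ℕ) (x : ℚ) → .{{_ : ℚ.NonZero x}} → ℤ
ord p x = + ordℕ p ∣ ↥ x ∣ ℤ.- + ordℕ p (↧ₙ x)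

p^1∣ : ∀ {p n} → p ∣ n → p ℕ.^ 1 ∣ n
p^1∣ {p} = ∣-trans (∣-reflexive (ℕₚ.*-identityʳ p))

largestExponent-∤ : ∀ p n e → p ∤ n → largestExponent p n e ≡ 0
largestExponent-∤ p n zero    p∤n = refl
largestExponent-∤ p n (suc e) p∤n with p ℕ.^ suc e ∣? n
... | yes d = contradiction (∣-trans (m∣m*n (p ℕ.^ e)) d) p∤n
... | no  _ = largestExponent-∤ p n e p∤n

largestExponent-∣ : ∀ p n e → p ∣ n → largestExponent p n (suc e) ≢ 0
largestExponent-∣ p n e p∣n eq with p ℕ.^ suc e ∣? n
largestExponent-∣ p n zero    p∣n eq | no ¬d = ¬d (p^1∣ p∣n)
largestExponent-∣ p n (suc e) p∣n eq | no _  = largestExponent-∣ p n e p∣n eq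

ordℕ-∤ : ∀ p n → p ∤ n → ordℕ p n ≡ 0
ordℕ-∤ p n = largestExponent-∤ p n n

ordℕ≡0⇒∤ : ∀ p n → .{{_ : ℕ.NonZero n}} → ordℕ p n ≡ 0 → p ∤ n
ordℕ≡0⇒∤ p (suc n) eq p∣n = largestExponent-∣ p (suc n) n p∣n eq

lowestTerms : ∀ x → Coprime ∣ ↥ x ∣ (↧ₙ x)
lowestTerms (ℚ.mkℚ _ _ c) = recompute c

numerator-nonZero : ∀ x → .{{_ : ℚ.NonZero x}} → ℕ.NonZero ∣ ↥ x ∣
numerator-nonZero (ℚ.mkℚ ℤ.+[1+ _ ] _ _) = _
numerator-nonZero (ℚ.mkℚ -[1+ _ ] _ _)   = _

module _ {p : ℕ} (pr : Prime p) (x : ℚ) .{{x≢0 : ℚ.NonZero x}} (ord≡0 : ord p x ≡ 0ℤ) where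

  private
    ordEq : ordℕ p ∣ ↥ x ∣ ≡ ordℕ p (↧ₙ x)
    ordEq = ℤₚ.+-injective (ℤₚ.i-j≡0⇒i≡j _ _ ord≡0)

    not-both : p ∣ ∣ ↥ x ∣ → p ∤ ↧ₙ x
    not-both p∣num p∣den = ¬prime[1] (subst Prime (lowestTerms x (p∣num , p∣den)) pr)

  p∤numerator : p ∤ ∣ ↥ x ∣
  p∤numerator p∣num =
    ordℕ≡0⇒∤ p _ {{numerator-nonZero x}} (trans ordEq (ordℕ-∤ p _ (not-both p∣num))) p∣num

  p∤denominator : p ∤ ↧ₙ x
  p∤denominator = ordℕ≡0⇒∤ p _ (trans (sym ordEq) (ordℕ-∤ p _ p∤numerator))

inverseModℕ : ∀ {p} → Prime p → ∀ m → p ∤ m → ∃[ w ] _≈ₙ_ p (+ m ℤ.* w) 1ℤ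
inverseModℕ {p} pr m p∤m with Bézout.identity (coprime⇒GCD≡1 coprime-pm)
  where
  coprime-pm : Coprime p m
  coprime-pm {d} (d∣p , d∣m) with prime⇒irreducible pr d∣p
  ... | inj₁ d≡1 = d≡1
  ... | inj₂ d≡p = contradiction (subst (_∣ m) d≡p d∣m) p∤m
... | Bézout.+- x y eq = ℤ.- + y , ℤ∣.divides (ℤ.- + x) (begin
    + m ℤ.* (ℤ.- + y) ℤ.- 1ℤ          ≡⟨ rearrange (+ m) (+ y) ⟩
    ℤ.- (1ℤ ℤ.+ + y ℤ.* + m)          ≡⟨ cong (λ z → ℤ.- (1ℤ ℤ.+ z)) (ℤₚ.pos-* y m) ⟨
    ℤ.- (+ (1 ℕ.+ y ℕ.* m))           ≡⟨ cong (λ z → ℤ.- (+ z)) eq ⟩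
    ℤ.- (+ (x ℕ.* p))                 ≡⟨ cong ℤ.-_ (ℤₚ.pos-* x p) ⟩
    ℤ.- (+ x ℤ.* + p)                 ≡⟨ ℤₚ.neg-distribˡ-* (+ x) (+ p) ⟩
    (ℤ.- + x) ℤ.* + p                 ∎)
  where
  open ≡-Reasoning
  rearrange : ∀ m y → m ℤ.* (ℤ.- y) ℤ.- 1ℤ ≡ ℤ.- (1ℤ ℤ.+ y ℤ.* m)
  rearrange = solve-∀
... | Bézout.-+ x y eq = + y , ℤ∣.divides (+ x) (begin
    + m ℤ.* + y ℤ.- 1ℤ                ≡⟨ cong (ℤ._- 1ℤ) (ℤₚ.*-comm (+ m) (+ y)) ⟩
    + y ℤ.* + m ℤ.- 1ℤ                ≡⟨ cong (ℤ._- 1ℤ) (ℤₚ.pos-* y m) ⟨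
    + (y ℕ.* m) ℤ.- 1ℤ                ≡⟨ cong (λ z → + z ℤ.- 1ℤ) eq ⟨
    (1ℤ ℤ.+ + (x ℕ.* p)) ℤ.- 1ℤ       ≡⟨ cancel (+ (x ℕ.* p)) ⟩
    + (x ℕ.* p)                       ≡⟨ ℤₚ.pos-* x p ⟩
    + x ℤ.* + p                       ∎)
  where
  open ≡-Reasoning
  cancel : ∀ z → (1ℤ ℤ.+ z) ℤ.- 1ℤ ≡ z
  cancel = solve-∀

inverseMod : ∀ {p} → Prime p → ∀ z → p ∤ ∣ z ∣ → ∃[ w ] _≈ₙ_ p (z ℤ.* w) 1ℤ
inverseMod     pr (+ m)    p∤m = inverseModℕ pr m p∤m
inverseMod {p} pr -[1+ m ] p∤m with inverseModℕ pr (suc m) p∤m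
... | w , d = ℤ.- w , subst (λ t → _≈ₙ_ p t 1ℤ) (neg-neg (+ suc m) w) d
  where
  neg-neg : ∀ s w → s ℤ.* w ≡ (ℤ.- s) ℤ.* (ℤ.- w)
  neg-neg = solve-∀

integerModPrime : ∀ {p} → Prime p → (z : ℤ) → p ∤ ∣ z ∣ → Group.Carrier (𝔽* p)
integerModPrime pr z p∤z = record
  { value   = z
  ; inverse = proj₁ (inverseMod pr z p∤z)
  ; isInv   = proj₂ (inverseMod pr z p∤z)
  }

-- In lowest terms, ord p x ≡ 0 makes both numerator and denominator prime to p.
reduction : ∀ {p} → Prime p → (x : ℚ) → .{{_ : ℚ.NonZero x}} →
            ord p x ≡ 0ℤ → Group.Carrier (𝔽* p)
reduction {p} pr x ord≡0 =
  integerModPrime pr (↥ x) (p∤numerator pr x ord≡0) //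
  integerModPrime pr (↧ x) (p∤denominator pr x ord≡0)
  where open Group (𝔽* p)

{-# OPTIONS --safe #-}

-- Write a = r / s and b = u / v in lowest terms and F k = r ^ k v − s ^ k u,
-- which independence keeps nonzero.  A prime p ∤ r s u v dividing F k gives
-- b ≡ a ^ k (mod p).  Given N, put P = N !.  For large k the powers of r and s
-- have a common period m modulo F k · P from exponent k on, whence
-- F (k + j) = F k · (1 + z P) for j = m and j = 2m.  One of these values
-- differs from F k, since otherwise r ^ m = s ^ m; then 1 + z P has a prime
-- divisor, and it exceeds N.
module Submission where

open import Defs
open import Algebra.Bundles using (Group; CommutativeMonoid)
import Algebra.Properties.CommutativeSemigroup as CommutativeSemigroupProperties
open import Data.Fin as Fin using (toℕ; fromℕ<)
open import Data.Fin.Properties using (pigeonhole; fromℕ<-injective)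
open import Data.Integer as ℤ
  using (ℤ; +_; -[1+_]; 0ℤ; 1ℤ; ∣_∣; _+_; _-_; _*_; -_; NonZero)
open import Data.Integer.Coprimality using (Coprime; coprime-divisor) renaming (sym to coprime-sym)
open import Data.Integer.DivMod using (_%ℕ_; _/ℕ_; n%ℕd<d; a≡a%ℕn+[a/ℕn]*n)
open import Data.Integer.Divisibility.Signed
open import Data.Integer.Properties
open import Data.Integer.Tactic.RingSolver using (solve-∀)
open import Data.List.Base using ([]; _∷_)
open import Data.List.Extrema.Nat using (max; xs≤max)
open import Data.List.Membership.Propositional using (_∉_)
open import Data.List.Relation.Unary.All using (All; []; _∷_; lookup)
open import Data.Nat as ℕ using (ℕ; zero; suc; _!; s≤s; z≤n)
import Data.Nat.Coprimality as ℕ-Coprimality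
import Data.Nat.Divisibility as ℕ∣
open import Data.Nat.GCD using (gcd; gcd[m,n]∣m; gcd[m,n]∣n)
open import Data.Nat.Induction using (<-wellFounded)
open import Data.Nat.Primality using (Prime; euclidsLemma; prime⇒nonZero; ¬prime[1])
open import Data.Nat.Primality.Factorisation using (factorise)
import Data.Nat.Properties as ℕₚ
open import Data.Product using (Σ-syntax; ∃-syntax; _×_; _,_; proj₁; proj₂)
open import Data.Rational as ℚ using (ℚ; 1ℚ; ↥_; ↧_; ↧ₙ_)
import Data.Rational.Properties as ℚₚ
import Data.Rational.Unnormalised as ℚᵘ
import Data.Rational.Unnormalised.Properties as ℚᵘₚ
open import Data.Sum using (_⊎_; inj₁; inj₂; [_,_]′)
open import Function.Base using (id)
open import Induction.WellFounded using (Acc; acc)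
open import Relation.Binary.PropositionalEquality
import Relation.Binary.Reasoning.Setoid as SetoidReasoning
open import Relation.Nullary using (¬_; Dec; yes; no; contradiction)
open import Relation.Unary using (_∈_)

-- Powers of an integer modulo another integer.

∣-^-cancel : ∀ d x n y → Coprime d x → d ∣ x ℤ.^ n * y → d ∣ y
∣-^-cancel d x zero    y c h = subst (d ∣_) (*-identityˡ y) h
∣-^-cancel d x (suc n) y c h = ∣-^-cancel d x n y c
  (∣ᵤ⇒∣ (coprime-divisor d x (x ℤ.^ n * y) c (∣⇒∣ᵤ (subst (d ∣_) (*-assoc x (x ℤ.^ n) y) h))))

x-1∣x^n-1 : ∀ x n → x - 1ℤ ∣ x ℤ.^ n - 1ℤ
x-1∣x^n-1 x zero    = divides 0ℤ refl
x-1∣x^n-1 x (suc n) = subst (x - 1ℤ ∣_) (identity x (x ℤ.^ n))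
  (∣m∣n⇒∣m+n (∣m⇒∣m*n (x ℤ.^ n) ∣-refl) (x-1∣x^n-1 x n))
  where
  identity : ∀ x y → (x - 1ℤ) * y + (y - 1ℤ) ≡ x * y - 1ℤ
  identity = solve-∀

-- Since `x ^ (m n) = (x ^ m) ^ n`, any multiple of a period is again a period. This merges the
-- periods of `r` and `s` and later doubles the common one.
x^m-1∣x^mn-1 : ∀ x m n → x ℤ.^ m - 1ℤ ∣ x ℤ.^ (m ℕ.* n) - 1ℤ
x^m-1∣x^mn-1 x m n =
  subst (λ z → x ℤ.^ m - 1ℤ ∣ z - 1ℤ) (^-*-assoc x m n) (x-1∣x^n-1 (x ℤ.^ m) n)

%ℕ-≡⇒∣ : ∀ x y n .{{_ : ℕ.NonZero n}} → x %ℕ n ≡ y %ℕ n → + n ∣ x - y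
%ℕ-≡⇒∣ x y n eq = divides (x /ℕ n - y /ℕ n) (begin
  x - y
    ≡⟨ cong₂ _-_ (a≡a%ℕn+[a/ℕn]*n x n) (a≡a%ℕn+[a/ℕn]*n y n) ⟩
  (+ (x %ℕ n) + x /ℕ n * + n) - (+ (y %ℕ n) + y /ℕ n * + n)
    ≡⟨ cong (λ z → (+ z + x /ℕ n * + n) - (+ (y %ℕ n) + y /ℕ n * + n)) eq ⟩
  (+ (y %ℕ n) + x /ℕ n * + n) - (+ (y %ℕ n) + y /ℕ n * + n)
    ≡⟨ identity (+ (y %ℕ n)) (x /ℕ n) (y /ℕ n) (+ n) ⟩
  (x /ℕ n - y /ℕ n) * + n ∎)
  where
  open ≡-Reasoning
  identity : ∀ t q q′ n → (t + q * n) - (t + q′ * n) ≡ (q - q′) * n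
  identity = solve-∀

-- Pigeonhole: among the first `∣ y ∣ + 1` powers of `x`, two agree modulo `y`, and coprimality
-- cancels the lower power from their difference.
finiteOrder : ∀ x y .{{_ : NonZero y}} → Coprime y x → ∃[ n ] y ∣ x ℤ.^ suc n - 1ℤ
finiteOrder x y c with pigeonhole (ℕₚ.n<1+n ∣ y ∣) residue
  where
  residue : Fin.Fin (suc ∣ y ∣) → Fin.Fin ∣ y ∣
  residue i = fromℕ< (n%ℕd<d (x ℤ.^ toℕ i) ∣ y ∣)
... | i , j , i<j , eq = n , ∣-^-cancel y x (toℕ i) _ c (subst (y ∣_) difference
      (∣-trans (∣ᵤ⇒∣ ℕ∣.∣-refl) (%ℕ-≡⇒∣ (x ℤ.^ toℕ j) (x ℤ.^ toℕ i) ∣ y ∣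
        (sym (fromℕ<-injective _ _ _ _ eq)))))
  where
  open ≡-Reasoning
  -- As `i < j`, the subtraction is exact and `suc n` is the gap between the colliding exponents.
  n = toℕ j ℕ.∸ suc (toℕ i)
  identity : ∀ x y → x * y - x ≡ x * (y - 1ℤ)
  identity = solve-∀
  difference : x ℤ.^ toℕ j - x ℤ.^ toℕ i ≡ x ℤ.^ toℕ i * (x ℤ.^ suc n - 1ℤ)
  difference = begin
    x ℤ.^ toℕ j - x ℤ.^ toℕ i
      ≡⟨ cong (λ m → x ℤ.^ m - x ℤ.^ toℕ i)
           (trans (ℕₚ.+-suc (toℕ i) n) (ℕₚ.m+[n∸m]≡n i<j)) ⟨
    x ℤ.^ (toℕ i ℕ.+ suc n) - x ℤ.^ toℕ i
      ≡⟨ cong (_- x ℤ.^ toℕ i) (^-distribˡ-+-* x (toℕ i) (suc n)) ⟩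
    x ℤ.^ toℕ i * x ℤ.^ suc n - x ℤ.^ toℕ i
      ≡⟨ identity (x ℤ.^ toℕ i) (x ℤ.^ suc n) ⟩
    x ℤ.^ toℕ i * (x ℤ.^ suc n - 1ℤ) ∎

-- Divide `C` by its gcd with `r` until that gcd is 1. Each gcd removed divides `r`, so the product
-- `c` of `e` of them divides `r ^ e`; the descent is on `∣ C ∣`, as every gcd removed is at least
-- 2.
splitOff : ∀ r C → NonZero C → ∃[ e ] ∃[ c ] ∃[ d ] C ≡ c * d × c ∣ r ℤ.^ e × Coprime r d
splitOff r C = go C (<-wellFounded ∣ C ∣)
  where
  go : ∀ C → Acc ℕ._<_ ∣ C ∣ → NonZero C →
       ∃[ e ] ∃[ c ] ∃[ d ] C ≡ c * d × c ∣ r ℤ.^ e × Coprime r d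
  go C (acc rec) C≢0 with gcd ∣ r ∣ ∣ C ∣ in eq
  ... | zero = contradiction (subst (ℕ∣._∣ ∣ C ∣) eq (gcd[m,n]∣n ∣ r ∣ ∣ C ∣))
                 λ 0∣C → ℕ.≢-nonZero⁻¹ ∣ C ∣ {{C≢0}} (ℕ∣.0∣⇒≡0 0∣C)
  ... | suc zero = 0 , 1ℤ , C , sym (*-identityˡ C) , ∣-refl , ℕ-Coprimality.gcd≡1⇒coprime eq
  ... | g@(suc (suc _)) with ∣ᵤ⇒∣ {+ g} {C} (subst (ℕ∣._∣ ∣ C ∣) eq (gcd[m,n]∣n ∣ r ∣ ∣ C ∣))
  ...   | divides q refl with go q (rec smaller) q≢0
    where
    q≢0 : NonZero q
    q≢0 = ℤ.≢-nonZero {q} λ { refl → ℕ.≢-nonZero⁻¹ 0 {{C≢0}} refl }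
    smaller : ∣ q ∣ ℕ.< ∣ q * + g ∣
    smaller = subst (∣ q ∣ ℕ.<_) (sym (abs-* q (+ g))) (ℕₚ.m<m*n ∣ q ∣ g {{q≢0}} (s≤s (s≤s z≤n)))
  ...     | e , c , d , refl , c∣ , cop =
    suc e , + g * c , d , identity c d (+ g) ,
    ∣-trans (*-monoˡ-∣ c g∣r) (*-monoʳ-∣ r c∣) , cop
    where
    g∣r : + g ∣ r
    g∣r = ∣ᵤ⇒∣ (subst (ℕ∣._∣ ∣ r ∣) eq (gcd[m,n]∣m ∣ r ∣ ∣ c * d * + g ∣))
    identity : ∀ c d g → c * d * g ≡ g * c * d
    identity = solve-∀

-- Removing from C its r-part c leaves, once c r ∣ r ^ k, a cofactor of
-- r ^ k W − s ^ k C that is prime to r.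
eventualPeriod : ∀ r s C W → NonZero C → Coprime r s →
  ∃[ e ] (∀ k → e ℕ.≤ k → let X = r ℤ.^ k * W - s ℤ.^ k * C in
          NonZero X → ∃[ n ] X ∣ r ℤ.^ k * (r ℤ.^ suc n - 1ℤ))
eventualPeriod r s C W C≢0 r⊥s with splitOff r C C≢0
... | e , c , d , refl , divides m r^e≡mc , r⊥d =
    -- `r ^ e` already absorbs `c`; the one further factor `r` survives in the first term of `Y`,
    -- which is what `Y⊥r` relies on.
    suc e , λ k e<k → subst Period (ℕₚ.m+[n∸m]≡n e<k) (period (k ℕ.∸ suc e))
  where
  open ≡-Reasoning
  Period : ℕ → Set
  Period k = let X = r ℤ.^ k * W - s ℤ.^ k * (c * d) in
             NonZero X → ∃[ n ] X ∣ r ℤ.^ k * (r ℤ.^ suc n - 1ℤ)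
  period : ∀ j → Period (suc e ℕ.+ j)
  period j X≢0 = n , subst (_∣ r ℤ.^ k * (r ℤ.^ suc n - 1ℤ)) (sym X≡cY)
      (∣-trans (*-monoˡ-∣ Y c∣r^k) (*-monoʳ-∣ (r ℤ.^ k) Y∣))
    where
    k = suc e ℕ.+ j
    X = r ℤ.^ k * W - s ℤ.^ k * (c * d)
    Y = r * (m * r ℤ.^ j) * W - s ℤ.^ k * d

    r^k≡ : r ℤ.^ k ≡ r * (m * c * r ℤ.^ j)
    r^k≡ = cong (r *_) (trans (^-distribˡ-+-* r e j) (cong (_* r ℤ.^ j) r^e≡mc))

    c∣r^k : c ∣ r ℤ.^ k
    c∣r^k = subst (c ∣_) (sym r^k≡)
      (∣n⇒∣m*n r (∣m⇒∣m*n (r ℤ.^ j) (divides m refl)))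

    X≡cY : X ≡ c * Y
    X≡cY = trans (cong (λ z → z * W - s ℤ.^ k * (c * d)) r^k≡)
                 (identity r m c (r ℤ.^ j) W (s ℤ.^ k) d)
      where
      identity : ∀ r m c R W S d →
        r * (m * c * R) * W - S * (c * d) ≡ c * (r * (m * R) * W - S * d)
      identity = solve-∀

    -- A common divisor of `Y` and `r` divides `s ^ k * d`. It is prime to `s` because `r` is, so it
    -- divides `d`, which is prime to `r`.
    Y⊥r : Coprime Y r
    Y⊥r {i} (i∣Y , i∣r) = r⊥d (i∣r , ∣⇒∣ᵤ i∣d)
      where
      i∣s^kd : + i ∣ s ℤ.^ k * d
      i∣s^kd = subst (+ i ∣_) (identity (r * (m * r ℤ.^ j) * W) (s ℤ.^ k * d))
        (∣m∣n⇒∣m-n (∣m⇒∣m*n W (∣m⇒∣m*n (m * r ℤ.^ j) (∣ᵤ⇒∣ {+ i} {r} i∣r))) (∣ᵤ⇒∣ {+ i} {Y} i∣Y))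
        where
        identity : ∀ x y → x - (x - y) ≡ y
        identity = solve-∀
      i∣d : + i ∣ d
      i∣d = ∣-^-cancel (+ i) s k d
        (λ (l∣i , l∣s) → r⊥s (ℕ∣.∣-trans l∣i i∣r , l∣s)) i∣s^kd

    Y≢0 : NonZero Y
    Y≢0 = ℤ.≢-nonZero λ Y≡0 → ℕ.≢-nonZero⁻¹ ∣ X ∣ {{X≢0}}
      (cong ∣_∣ (trans X≡cY (trans (cong (c *_) Y≡0) (*-zeroʳ c))))

    order = finiteOrder r Y {{Y≢0}} Y⊥r
    n  = proj₁ order
    Y∣ = proj₂ order

-- Nonvanishing, and prime divisors beyond a bound.

*-≢0 : ∀ {x y} → x ≢ 0ℤ → y ≢ 0ℤ → x * y ≢ 0ℤ
*-≢0 {x} x≢0 y≢0 xy≡0 = [ x≢0 , y≢0 ]′ (i*j≡0⇒i≡0∨j≡0 x xy≡0)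

^-≢0 : ∀ {x} n → x ≢ 0ℤ → x ℤ.^ n ≢ 0ℤ
^-≢0 {x} n x≢0 x^n≡0 = x≢0 (i^n≡0⇒i≡0 x n x^n≡0)

∣n! : ∀ {p n} .{{_ : ℕ.NonZero p}} → p ℕ.≤ n → p ℕ∣.∣ n !
∣n! {suc p} p≤n = ℕ∣.∣-trans (ℕ∣.m∣m*n (p !)) (ℕ∣.m≤n⇒m!∣n! p≤n)

primeDivisor : ∀ n → n ≢ 0 → n ≢ 1 → ∃[ p ] Prime p × p ℕ∣.∣ n
primeDivisor n n≢0 n≢1 with factorise n {{ℕ.≢-nonZero n≢0}}
... | record { factors = []    ; isFactorisation = eq } = contradiction eq n≢1
... | record { factors = p ∷ _ ; isFactorisation = eq ; factorsPrime = pr ∷ _ } =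
  p , pr , subst (p ℕ∣.∣_) (sym eq) (ℕ∣.m∣m*n _)

∣i∣≡1⇒i≡±1 : ∀ i → ∣ i ∣ ≡ 1 → i ≡ 1ℤ ⊎ i ≡ -[1+ 0 ]
∣i∣≡1⇒i≡±1 (+ 1)    refl = inj₁ refl
∣i∣≡1⇒i≡±1 -[1+ 0 ] refl = inj₂ refl

-- 3 ∣ N ! keeps 1 + z N ! away from 0 and -1.
primeDivisor>N : ∀ N z → 3 ℕ.≤ N → 1ℤ + z * + (N !) ≢ 1ℤ →
  ∃[ p ] Prime p × + p ∣ 1ℤ + z * + (N !) × N ℕ.< p
primeDivisor>N N z 3≤N Q≢1 = p , pr , p∣Q , ℕₚ.≰⇒> p≰N
  where
  Q = 1ℤ + z * + (N !)

  -- Such a `d` divides `N !`, hence the second summand of `Q`; a prime divisor of `Q` up to `N`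
  -- would therefore divide 1.
  ∣1 : ∀ {d} .{{_ : ℕ.NonZero d}} → d ℕ.≤ N → + d ∣ Q → + d ∣ 1ℤ
  ∣1 {d} d≤N d∣Q = ∣m+n∣n⇒∣m d∣Q (∣n⇒∣m*n z (∣ᵤ⇒∣ {+ d} {+ (N !)} (∣n! d≤N)))

  3∣Q-1 : + 3 ∣ Q - 1ℤ
  3∣Q-1 = subst (+ 3 ∣_) (identity (z * + (N !))) (∣n⇒∣m*n z (∣ᵤ⇒∣ {+ 3} {+ (N !)} (∣n! 3≤N)))
    where
    identity : ∀ x → x ≡ (1ℤ + x) - 1ℤ
    identity = solve-∀

  Q≢0 : Q ≢ 0ℤ
  Q≢0 eq with ℕ∣.∣1⇒≡1 (∣⇒∣ᵤ (subst (λ q → + 3 ∣ q - 1ℤ) eq 3∣Q-1))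
  ... | ()

  Q≢-1 : Q ≢ -[1+ 0 ]
  Q≢-1 eq with ℕ∣.∣⇒≤ (∣⇒∣ᵤ (subst (λ q → + 3 ∣ q - 1ℤ) eq 3∣Q-1))
  ... | s≤s (s≤s ())

  ∣Q∣≢1 : ∣ Q ∣ ≢ 1
  ∣Q∣≢1 eq = [ Q≢1 , Q≢-1 ]′ (∣i∣≡1⇒i≡±1 Q eq)

  divisor = primeDivisor ∣ Q ∣ (λ eq → Q≢0 (∣i∣≡0⇒i≡0 eq)) ∣Q∣≢1
  p  = proj₁ divisor
  pr = proj₁ (proj₂ divisor)
  p∣Q : + p ∣ Q
  p∣Q = ∣ᵤ⇒∣ (proj₂ (proj₂ divisor))
  p≰N : ¬ p ℕ.≤ N
  p≰N p≤N = ¬prime[1] (subst Prime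
    (ℕ∣.∣1⇒≡1 (∣⇒∣ᵤ (∣1 {{prime⇒nonZero pr}} p≤N p∣Q))) pr)

-- The sequence `F`: common periods and large prime divisors.

module _ (r s u v : ℤ) where

  -- For `a = r / s` and `b = u / v` this is the numerator of `a ^ k - b` over the denominator
  -- `s ^ k * v`.
  F : ℕ → ℤ
  F k = r ℤ.^ k * v - s ℤ.^ k * u

  -- The difference is `v` times the first given multiple of `X` minus `u` times the second.
  F-shift : ∀ {X} k j → X ∣ r ℤ.^ k * (r ℤ.^ j - 1ℤ) → X ∣ s ℤ.^ k * (s ℤ.^ j - 1ℤ) →
            X ∣ F (k ℕ.+ j) - F k
  F-shift {X} k j X∣r X∣s = subst (X ∣_) eq (∣m∣n⇒∣m-n (∣n⇒∣m*n v X∣r) (∣n⇒∣m*n u X∣s))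
    where
    identity : ∀ v R A u S B →
      v * (R * (A - 1ℤ)) - u * (S * (B - 1ℤ)) ≡ (R * A * v - S * B * u) - (R * v - S * u)
    identity = solve-∀
    eq = trans (identity v (r ℤ.^ k) (r ℤ.^ j) u (s ℤ.^ k) (s ℤ.^ j))
               (cong₂ (λ x y → (x * v - y * u) - F k)
                 (sym (^-distribˡ-+-* r k j)) (sym (^-distribˡ-+-* s k j)))

  -- `eventualPeriod` is applied twice, with `r` and `s` interchanged. Scaling both `u` and `v` by
  -- `P` turns its modulus into `F k * P`, up to sign in the second use.
  commonPeriod : Coprime r s → u ≢ 0ℤ → v ≢ 0ℤ → (∀ k → F k ≢ 0ℤ) → ∀ P → P ≢ 0ℤ →
    ∃[ k ] ∃[ n ] (F k * P ∣ r ℤ.^ k * (r ℤ.^ suc n - 1ℤ)) ×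
                  (F k * P ∣ s ℤ.^ k * (s ℤ.^ suc n - 1ℤ))
  commonPeriod r⊥s u≢0 v≢0 F≢0 P P≢0
    with eventualPeriod r s (u * P) (v * P) (ℤ.≢-nonZero (*-≢0 u≢0 P≢0)) r⊥s
       | eventualPeriod s r (v * P) (u * P) (ℤ.≢-nonZero (*-≢0 v≢0 P≢0)) (coprime-sym {r} {s} r⊥s)
  -- The second component is the predecessor of `suc n * suc n′`, a common multiple of the two
  -- periods.
  ... | e , f | e′ , f′ = k , n′ ℕ.+ n ℕ.* suc n′ , X∣r , X∣s
    where
    -- The sum lies beyond both thresholds.
    k = e ℕ.+ e′
    X = F k * P

    X≡ : r ℤ.^ k * (v * P) - s ℤ.^ k * (u * P) ≡ X
    X≡ = identity (r ℤ.^ k) v (s ℤ.^ k) u P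
      where
      identity : ∀ R v S u P → R * (v * P) - S * (u * P) ≡ (R * v - S * u) * P
      identity = solve-∀

    -X≡ : s ℤ.^ k * (u * P) - r ℤ.^ k * (v * P) ≡ - X
    -X≡ = identity (r ℤ.^ k) v (s ℤ.^ k) u P
      where
      identity : ∀ R v S u P → S * (u * P) - R * (v * P) ≡ - ((R * v - S * u) * P)
      identity = solve-∀

    X≢0 : NonZero X
    X≢0 = ℤ.≢-nonZero (*-≢0 (F≢0 k) P≢0)

    -X≢0 : NonZero (- X)
    -X≢0 = subst ℕ.NonZero (sym (∣-i∣≡∣i∣ X)) X≢0

    rPeriod = f k (ℕₚ.m≤m+n e e′) (subst NonZero (sym X≡) X≢0)
    sPeriod = f′ k (ℕₚ.m≤n+m e′ e) (subst NonZero (sym -X≡) -X≢0)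
    n  = proj₁ rPeriod
    n′ = proj₁ sPeriod

    X∣r : X ∣ r ℤ.^ k * (r ℤ.^ (suc n ℕ.* suc n′) - 1ℤ)
    X∣r = ∣-trans (subst (_∣ r ℤ.^ k * (r ℤ.^ suc n - 1ℤ)) X≡ (proj₂ rPeriod))
                  (*-monoʳ-∣ (r ℤ.^ k) (x^m-1∣x^mn-1 r (suc n) (suc n′)))

    X∣s : X ∣ s ℤ.^ k * (s ℤ.^ (suc n ℕ.* suc n′) - 1ℤ)
    X∣s = ∣-trans (∣-trans (∣ᵤ⇒∣ (ℕ∣.∣-reflexive (sym (∣-i∣≡∣i∣ X))))
                    (subst (_∣ s ℤ.^ k * (s ℤ.^ suc n′ - 1ℤ)) -X≡ (proj₂ sPeriod)))
                  (*-monoʳ-∣ (s ℤ.^ k) (subst (λ m → s ℤ.^ suc n′ - 1ℤ ∣ s ℤ.^ m - 1ℤ)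
                    (ℕₚ.*-comm (suc n′) (suc n)) (x^m-1∣x^mn-1 s (suc n′) (suc n))))

  -- In the notation below, the hypotheses read `x (A - 1) = y (B - 1)` and
  -- `x (A² - 1) = y (B² - 1)`. Subtracting `1 + B` times the first from the second leaves
  -- `x (A - 1) (A - B) = 0`. If `A = 1`, the first relation forces `B = 1` as well.
  F-repeats⇒≡ : r ≢ 0ℤ → s ≢ 0ℤ → u ≢ 0ℤ → v ≢ 0ℤ → ∀ k m →
    F (k ℕ.+ m) ≡ F k → F (k ℕ.+ (m ℕ.+ m)) ≡ F k → r ℤ.^ m ≡ s ℤ.^ m
  F-repeats⇒≡ r≢0 s≢0 u≢0 v≢0 k m eq₁ eq₂ =
    [ A≡1⇒A≡B , i-j≡0⇒i≡j A B ]′ (i*j≡0⇒i≡0∨j≡0 (A - 1ℤ) product≡0)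
    where
    open ≡-Reasoning
    A = r ℤ.^ m
    B = s ℤ.^ m
    x = r ℤ.^ k * v
    y = s ℤ.^ k * u
    x≢0 = *-≢0 (^-≢0 k r≢0) v≢0
    y≢0 = *-≢0 (^-≢0 k s≢0) u≢0

    relation : ∀ j → F (k ℕ.+ j) ≡ F k → x * (r ℤ.^ j - 1ℤ) ≡ y * (s ℤ.^ j - 1ℤ)
    relation j eq = i-j≡0⇒i≡j _ _ (begin
      x * (r ℤ.^ j - 1ℤ) - y * (s ℤ.^ j - 1ℤ)
        ≡⟨ identity (r ℤ.^ k) (r ℤ.^ j) v (s ℤ.^ k) (s ℤ.^ j) u ⟩
      (r ℤ.^ k * r ℤ.^ j * v - s ℤ.^ k * s ℤ.^ j * u) - F k
        ≡⟨ cong₂ (λ x y → (x * v - y * u) - F k) (^-distribˡ-+-* r k j) (^-distribˡ-+-* s k j) ⟨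
      F (k ℕ.+ j) - F k
        ≡⟨ i≡j⇒i-j≡0 eq ⟩
      0ℤ ∎)
      where
      identity : ∀ R A v S B u →
        R * v * (A - 1ℤ) - S * u * (B - 1ℤ) ≡ (R * A * v - S * B * u) - (R * v - S * u)
      identity = solve-∀

    single : x * (A - 1ℤ) ≡ y * (B - 1ℤ)
    single = relation m eq₁

    double : x * (A * A - 1ℤ) ≡ y * (B * B - 1ℤ)
    double = subst₂ (λ a b → x * (a - 1ℤ) ≡ y * (b - 1ℤ))
      (^-distribˡ-+-* r m m) (^-distribˡ-+-* s m m) (relation (m ℕ.+ m) eq₂)

    product≡0 : (A - 1ℤ) * (A - B) ≡ 0ℤ
    product≡0 = [ (λ x≡0 → contradiction x≡0 x≢0) , id ]′ (i*j≡0⇒i≡0∨j≡0 x (begin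
      x * ((A - 1ℤ) * (A - B))
        ≡⟨ left x A B ⟩
      x * (A * A - 1ℤ) - (1ℤ + B) * (x * (A - 1ℤ))
        ≡⟨ cong₂ (λ p q → p - (1ℤ + B) * q) double single ⟩
      y * (B * B - 1ℤ) - (1ℤ + B) * (y * (B - 1ℤ))
        ≡⟨ right y B ⟩
      0ℤ ∎))
      where
      left : ∀ x A B → x * ((A - 1ℤ) * (A - B)) ≡ x * (A * A - 1ℤ) - (1ℤ + B) * (x * (A - 1ℤ))
      left = solve-∀
      right : ∀ y B → y * (B * B - 1ℤ) - (1ℤ + B) * (y * (B - 1ℤ)) ≡ 0ℤ
      right = solve-∀

    A≡1⇒A≡B : A - 1ℤ ≡ 0ℤ → A ≡ B
    A≡1⇒A≡B A-1≡0 = trans (i-j≡0⇒i≡j A 1ℤ A-1≡0) (sym (i-j≡0⇒i≡j B 1ℤ B-1≡0))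
      where
      B-1≡0 : B - 1ℤ ≡ 0ℤ
      B-1≡0 = [ (λ y≡0 → contradiction y≡0 y≢0) , id ]′ (i*j≡0⇒i≡0∨j≡0 y (begin
        y * (B - 1ℤ) ≡⟨ single ⟨
        x * (A - 1ℤ) ≡⟨ cong (x *_) A-1≡0 ⟩
        x * 0ℤ       ≡⟨ *-zeroʳ x ⟩
        0ℤ           ∎))

  primeDivisorOfF : Coprime r s → r ≢ 0ℤ → s ≢ 0ℤ → u ≢ 0ℤ → v ≢ 0ℤ →
    (∀ k → F k ≢ 0ℤ) → (∀ m → r ℤ.^ suc m ≢ s ℤ.^ suc m) →
    ∀ N → 3 ℕ.≤ N → ∃[ p ] ∃[ k ] Prime p × + p ∣ F k × N ℕ.< p
  primeDivisorOfF r⊥s r≢0 s≢0 u≢0 v≢0 F≢0 r^m≢s^m N 3≤N =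
    choose (F (k ℕ.+ m) ≟ F k) (F (k ℕ.+ (m ℕ.+ m)) ≟ F k)
    where
    N!≢0 : + (N !) ≢ 0ℤ
    N!≢0 eq = ℕ.≢-nonZero⁻¹ (N !) {{N ℕₚ.!≢0}} (+-injective eq)
    period = commonPeriod r⊥s u≢0 v≢0 F≢0 (+ (N !)) N!≢0
    k   = proj₁ period
    m   = suc (proj₁ (proj₂ period))
    X∣r = proj₁ (proj₂ (proj₂ period))
    X∣s = proj₂ (proj₂ (proj₂ period))
    X = F k * + (N !)

    fromDifference : ∀ k′ → X ∣ F k′ - F k → F k′ ≢ F k →
                     ∃[ p ] ∃[ k ] Prime p × + p ∣ F k × N ℕ.< p
    -- The divisibility says `F k′ = F k * Q` with `Q = 1 + z N !`, and `F k′ ≢ F k` excludes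
    -- `Q = 1`. The prime found in `Q` divides `F` at the shifted index `k′`.
    fromDifference k′ (divides z eq) F≢ =
      p , k′ , pr , subst (+ p ∣_) (sym Fk′≡) (∣n⇒∣m*n (F k) p∣Q) , N<p
      where
      Q = 1ℤ + z * + (N !)
      Fk′≡ : F k′ ≡ F k * Q
      Fk′≡ = trans (split (F k′) (F k)) (trans (cong (_+ F k) eq) (factor z (F k) (+ (N !))))
        where
        split : ∀ x y → x ≡ (x - y) + y
        split = solve-∀
        factor : ∀ z f P → z * (f * P) + f ≡ f * (1ℤ + z * P)
        factor = solve-∀
      divisor = primeDivisor>N N z 3≤N
        λ Q≡1 → F≢ (trans Fk′≡ (trans (cong (F k *_) Q≡1) (*-identityʳ (F k))))
      p   = proj₁ divisor
      pr  = proj₁ (proj₂ divisor)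
      p∣Q = proj₁ (proj₂ (proj₂ divisor))
      N<p = proj₂ (proj₂ (proj₂ divisor))

    double : ∀ x → X ∣ x ℤ.^ k * (x ℤ.^ m - 1ℤ) → X ∣ x ℤ.^ k * (x ℤ.^ (m ℕ.+ m) - 1ℤ)
    double x X∣ = ∣-trans X∣ (*-monoʳ-∣ (x ℤ.^ k)
      (subst (λ j → x ℤ.^ m - 1ℤ ∣ x ℤ.^ j - 1ℤ) m*2≡m+m (x^m-1∣x^mn-1 x m 2)))
      where
      m*2≡m+m : m ℕ.* 2 ≡ m ℕ.+ m
      m*2≡m+m = trans (ℕₚ.*-comm m 2) (cong (m ℕ.+_) (ℕₚ.+-identityʳ m))

    choose : Dec (F (k ℕ.+ m) ≡ F k) → Dec (F (k ℕ.+ (m ℕ.+ m)) ≡ F k) →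
             ∃[ p ] ∃[ k ] Prime p × + p ∣ F k × N ℕ.< p
    choose (no F≢)  _        = fromDifference (k ℕ.+ m) (F-shift k m X∣r X∣s) F≢
    choose (yes _)  (no F≢)  =
      fromDifference (k ℕ.+ (m ℕ.+ m)) (F-shift k (m ℕ.+ m) (double r X∣r) (double s X∣s)) F≢
    choose (yes eq) (yes eq₂) =
      contradiction (F-repeats⇒≡ r≢0 s≢0 u≢0 v≢0 k m eq eq₂) (r^m≢s^m (proj₁ (proj₂ period)))

-- Clearing denominators, and the consequences of independence.

ι : ℤ → ℚ
ι z = z ℚ./ 1

toℚᵘ-ι : ∀ z → ℚ.toℚᵘ (ι z) ℚᵘ.≃ ℚᵘ.mkℚᵘ z 0
toℚᵘ-ι z = ℚₚ.toℚᵘ-fromℚᵘ (ℚᵘ.mkℚᵘ z 0)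

ι-* : ∀ x y → ι (x * y) ≡ ι x ℚ.* ι y
ι-* x y = ℚₚ.toℚᵘ-injective (begin
  ℚ.toℚᵘ (ι (x * y))                ≈⟨ toℚᵘ-ι (x * y) ⟩
  ℚᵘ.mkℚᵘ x 0 ℚᵘ.* ℚᵘ.mkℚᵘ y 0      ≈⟨ ℚᵘₚ.*-cong (toℚᵘ-ι x) (toℚᵘ-ι y) ⟨
  ℚ.toℚᵘ (ι x) ℚᵘ.* ℚ.toℚᵘ (ι y)    ≈⟨ ℚₚ.toℚᵘ-homo-* (ι x) (ι y) ⟨
  ℚ.toℚᵘ (ι x ℚ.* ι y)              ∎)
  where open SetoidReasoning ℚᵘₚ.≃-setoid

ι-injective : ∀ {x y} → ι x ≡ ι y → x ≡ y
ι-injective {x} {y} eq =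
  trans (sym (*-identityʳ x)) (trans (ℚᵘₚ.drop-*≡* x≃y) (*-identityʳ y))
  where
  x≃y = ℚᵘₚ.≃-trans (ℚᵘₚ.≃-sym (toℚᵘ-ι x)) (ℚᵘₚ.≃-trans (ℚᵘₚ.≃-reflexive (cong ℚ.toℚᵘ eq)) (toℚᵘ-ι y))

ι-↧-* : ∀ q → ι (↧ q) ℚ.* q ≡ ι (↥ q)
ι-↧-* q@(ℚ.mkℚ n d _) = ℚₚ.toℚᵘ-injective (begin
  ℚ.toℚᵘ (ι (↧ q) ℚ.* q)                  ≈⟨ ℚₚ.toℚᵘ-homo-* (ι (↧ q)) q ⟩
  ℚ.toℚᵘ (ι (↧ q)) ℚᵘ.* ℚ.toℚᵘ q          ≈⟨ ℚᵘₚ.*-cong (toℚᵘ-ι (↧ q)) ℚᵘₚ.≃-refl ⟩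
  ℚᵘ.mkℚᵘ (↧ q) 0 ℚᵘ.* ℚ.toℚᵘ q           ≈⟨ ℚᵘ.*≡* clear ⟩
  ℚᵘ.mkℚᵘ (↥ q) 0                         ≈⟨ toℚᵘ-ι (↥ q) ⟨
  ℚ.toℚᵘ (ι (↥ q))                        ∎)
  where
  open SetoidReasoning ℚᵘₚ.≃-setoid
  clear : ↧ q * n * 1ℤ ≡ n * (+ suc (d ℕ.+ 0))
  clear = trans (*-identityʳ (↧ q * n))
    (trans (*-comm (↧ q) n) (cong (λ m → n * + suc m) (sym (ℕₚ.+-identityʳ d))))

*-cancelˡ-ι : ∀ z {x y} → z ≢ 0ℤ → ι z ℚ.* x ≡ ι z ℚ.* y → x ≡ y
*-cancelˡ-ι z {x} {y} z≢0 eq = begin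
  x                               ≡⟨ uncancel x ⟩
  ℚ.1/ ι z ℚ.* (ι z ℚ.* x)        ≡⟨ cong (ℚ.1/ ι z ℚ.*_) eq ⟩
  ℚ.1/ ι z ℚ.* (ι z ℚ.* y)        ≡⟨ uncancel y ⟨
  y                               ∎
  where
  open ≡-Reasoning
  instance
    ιz≢0 : ℚ.NonZero (ι z)
    ιz≢0 = ℚ.≢-nonZero λ ιz≡0 → z≢0 (ι-injective ιz≡0)
  uncancel : ∀ w → w ≡ ℚ.1/ ι z ℚ.* (ι z ℚ.* w)
  uncancel w = begin
    w                              ≡⟨ ℚₚ.*-identityˡ w ⟨
    1ℚ ℚ.* w                       ≡⟨ cong (ℚ._* w) (ℚₚ.*-inverseˡ (ι z)) ⟨
    ℚ.1/ ι z ℚ.* ι z ℚ.* w         ≡⟨ ℚₚ.*-assoc (ℚ.1/ ι z) (ι z) w ⟩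
    ℚ.1/ ι z ℚ.* (ι z ℚ.* w)       ∎

module _ (a : ℚ) .{{_ : ℚ.NonZero a}} where
  open CommutativeSemigroupProperties
    (CommutativeMonoid.commutativeSemigroup ℚₚ.*-1-commutativeMonoid)
    using (interchange; x∙yz≈y∙xz)
  open ≡-Reasoning

  ι-↧^-* : ∀ k → ι (↧ a ℤ.^ k) ℚ.* a ^ (+ k) ≡ ι (↥ a ℤ.^ k)
  ι-↧^-* zero    = refl
  ι-↧^-* (suc k) = begin
    ι (↧ a * ↧ a ℤ.^ k) ℚ.* (a ℚ.* a ^ (+ k))
      ≡⟨ cong (ℚ._* (a ℚ.* a ^ (+ k))) (ι-* (↧ a) (↧ a ℤ.^ k)) ⟩
    ι (↧ a) ℚ.* ι (↧ a ℤ.^ k) ℚ.* (a ℚ.* a ^ (+ k))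
      ≡⟨ interchange (ι (↧ a)) (ι (↧ a ℤ.^ k)) a (a ^ (+ k)) ⟩
    ι (↧ a) ℚ.* a ℚ.* (ι (↧ a ℤ.^ k) ℚ.* a ^ (+ k))
      ≡⟨ cong₂ ℚ._*_ (ι-↧-* a) (ι-↧^-* k) ⟩
    ι (↥ a) ℚ.* ι (↥ a ℤ.^ k)
      ≡⟨ ι-* (↥ a) (↥ a ℤ.^ k) ⟨
    ι (↥ a * ↥ a ℤ.^ k) ∎

  -- Multiplied by `↧ q * ↧ a ^ k`, both sides become integers, equal by hypothesis; the multiplier
  -- is nonzero and cancels.
  power≡ : ∀ k q → ↥ a ℤ.^ k * ↧ q ≡ ↧ a ℤ.^ k * ↥ q → a ^ (+ k) ≡ q
  power≡ k q eq = *-cancelˡ-ι (↧ q * ↧ a ℤ.^ k) (*-≢0 {↧ q} (λ ()) (^-≢0 {↧ a} k λ ())) (begin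
    ι (↧ q * ↧ a ℤ.^ k) ℚ.* a ^ (+ k)
      ≡⟨ cong (ℚ._* a ^ (+ k)) (ι-* (↧ q) (↧ a ℤ.^ k)) ⟩
    ι (↧ q) ℚ.* ι (↧ a ℤ.^ k) ℚ.* a ^ (+ k)
      ≡⟨ ℚₚ.*-assoc (ι (↧ q)) (ι (↧ a ℤ.^ k)) (a ^ (+ k)) ⟩
    ι (↧ q) ℚ.* (ι (↧ a ℤ.^ k) ℚ.* a ^ (+ k))
      ≡⟨ cong (ι (↧ q) ℚ.*_) (ι-↧^-* k) ⟩
    ι (↧ q) ℚ.* ι (↥ a ℤ.^ k)
      ≡⟨ ι-* (↧ q) (↥ a ℤ.^ k) ⟨
    ι (↧ q * ↥ a ℤ.^ k)
      ≡⟨ cong ι (trans (*-comm (↧ q) (↥ a ℤ.^ k)) eq) ⟩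
    ι (↧ a ℤ.^ k * ↥ q)
      ≡⟨ ι-* (↧ a ℤ.^ k) (↥ q) ⟩
    ι (↧ a ℤ.^ k) ℚ.* ι (↥ q)
      ≡⟨ cong (ι (↧ a ℤ.^ k) ℚ.*_) (ι-↧-* q) ⟨
    ι (↧ a ℤ.^ k) ℚ.* (ι (↧ q) ℚ.* q)
      ≡⟨ x∙yz≈y∙xz (ι (↧ a ℤ.^ k)) (ι (↧ q)) q ⟩
    ι (↧ q) ℚ.* (ι (↧ a ℤ.^ k) ℚ.* q)
      ≡⟨ ℚₚ.*-assoc (ι (↧ q)) (ι (↧ a ℤ.^ k)) q ⟨
    ι (↧ q) ℚ.* ι (↧ a ℤ.^ k) ℚ.* q
      ≡⟨ cong (ℚ._* q) (ι-* (↧ q) (↧ a ℤ.^ k)) ⟨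
    ι (↧ q * ↧ a ℤ.^ k) ℚ.* q ∎)

module _ (a b : ℚ) .{{_ : ℚ.NonZero a}} .{{_ : ℚ.NonZero b}}
         (indep : MultiplicativelyIndependent a b) where

  -- A zero of `F` means `a ^ k = b`, the relation with exponents `k` and -1. It is nontrivial even
  -- at `k = 0`, thanks to the second exponent.
  independent⇒F≢0 : ∀ k → F (↥ a) (↧ a) (↥ b) (↧ b) k ≢ 0ℤ
  independent⇒F≢0 k F≡0 = indep (+ k , -[1+ 0 ] , (λ { (_ , ()) }) , (begin
    a ^ (+ k) ℚ.* (ℚ.1/ b ℚ.* 1ℚ) ≡⟨ cong₂ ℚ._*_ (power≡ a k b (i-j≡0⇒i≡j _ _ F≡0)) (ℚₚ.*-identityʳ (ℚ.1/ b)) ⟩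
    b ℚ.* ℚ.1/ b                  ≡⟨ ℚₚ.*-inverseʳ b ⟩
    1ℚ                            ∎))
    where open ≡-Reasoning

  -- Equality would make `a ^ suc m = 1`, a relation with second exponent 0.
  independent⇒^≢ : ∀ m → ↥ a ℤ.^ suc m ≢ ↧ a ℤ.^ suc m
  independent⇒^≢ m eq = indep (+ suc m , 0ℤ , (λ { (() , _) }) ,
    cong (ℚ._* 1ℚ) (power≡ a (suc m) 1ℚ (cong (_* 1ℤ) eq)))

-- Reduction modulo a prime.

prime∣* : ∀ {p} → Prime p → ∀ x y → + p ∣ x * y → (+ p ∣ x) ⊎ (+ p ∣ y)
prime∣* {p} pr x y p∣xy with euclidsLemma ∣ x ∣ ∣ y ∣ pr (subst (p ℕ∣.∣_) (abs-* x y) (∣⇒∣ᵤ p∣xy))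
... | inj₁ p∣x = inj₁ (∣ᵤ⇒∣ p∣x)
... | inj₂ p∣y = inj₂ (∣ᵤ⇒∣ p∣y)

prime∣*-cancel : ∀ {p} → Prime p → ∀ x y → ¬ (+ p ∣ x) → + p ∣ x * y → + p ∣ y
prime∣*-cancel pr x y p∤x p∣xy = [ (λ p∣x → contradiction p∣x p∤x) , id ]′ (prime∣* pr x y p∣xy)

prime∣^ : ∀ {p} → Prime p → ∀ x n → + p ∣ x ℤ.^ n → + p ∣ x
prime∣^ {p} pr x zero    p∣1 = contradiction (subst Prime (ℕ∣.∣1⇒≡1 (∣⇒∣ᵤ p∣1)) pr) ¬prime[1]
prime∣^ {p} pr x (suc n) h   = [ id , prime∣^ pr x n ]′ (prime∣* pr x (x ℤ.^ n) h)

-- Numerator and denominator are nonzero and smaller than `p` in absolute value, so `p` divides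
-- neither and both exponents vanish.
large⇒ord≡0 : ∀ x .{{_ : ℚ.NonZero x}} {N p} → ∣ ↥ x ∣ ℕ.≤ N → ↧ₙ x ℕ.≤ N → N ℕ.< p → ord p x ≡ 0ℤ
large⇒ord≡0 x {p = p} num≤N den≤N N<p =
  cong₂ (λ m n → + m - + n) (ordℕ-∤ p _ (p∤ _ {{numerator-nonZero x}} num≤N)) (ordℕ-∤ p _ (p∤ (↧ₙ x) den≤N))
  where
  p∤ : ∀ n .{{_ : ℕ.NonZero n}} → n ℕ.≤ _ → p ℕ∣.∤ n
  p∤ n n≤N = ℕ∣.>⇒∤ (ℕₚ.≤-<-trans n≤N N<p)

module _ {p : ℕ} (pr : Prime p) (a b : ℚ) .{{_ : ℚ.NonZero a}} .{{_ : ℚ.NonZero b}}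
         (a0 : ord p a ≡ 0ℤ) (b0 : ord p b ≡ 0ℤ) where

  private
    value : Group.Carrier (𝔽* p) → ℤ
    value = Unit.value
    s⁻¹ = proj₁ (inverseMod pr (↧ a) (p∤denominator pr a a0))
    v⁻¹ = proj₁ (inverseMod pr (↧ b) (p∤denominator pr b b0))
    ss⁻¹≈1 : + p ∣ ↧ a * s⁻¹ - 1ℤ
    ss⁻¹≈1 = proj₂ (inverseMod pr (↧ a) (p∤denominator pr a a0))
    vv⁻¹≈1 : + p ∣ ↧ b * v⁻¹ - 1ℤ
    vv⁻¹≈1 = proj₂ (inverseMod pr (↧ b) (p∤denominator pr b b0))

    W : ℕ → ℤ
    W k = value (power (𝔽* p) (reduction pr a a0) (+ k))

  -- The reduction of `a` is represented by `↥ a * s⁻¹`, so modulo `p` each factor `↧ a` cancels one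
  -- `s⁻¹` in its `k`-th power `W k`.
  ↧^*-reduction^ : ∀ k → + p ∣ ↧ a ℤ.^ k * W k - ↥ a ℤ.^ k
  ↧^*-reduction^ zero    = divides 0ℤ refl
  ↧^*-reduction^ (suc k) = subst (+ p ∣_) (identity (↥ a) (↧ a) s⁻¹ (↧ a ℤ.^ k) (W k) (↥ a ℤ.^ k))
    (∣n⇒∣m*n (↥ a) (∣m∣n⇒∣m+n (∣m⇒∣m*n (↧ a ℤ.^ k * W k) ss⁻¹≈1) (↧^*-reduction^ k)))
    where
    identity : ∀ r s s⁻¹ S W R →
      r * ((s * s⁻¹ - 1ℤ) * (S * W) + (S * W - R)) ≡ s * S * (r * s⁻¹ * W) - r * R
    identity = solve-∀

  -- The exponent is `k` itself. Multiplying `↥ b * v⁻¹ - W k` by `↧ b * ↧ a ^ k` gives `- F k` up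
  -- to multiples of `p`; that multiplier is prime to `p` and cancels.
  reduction∈cyclic : ∀ k → + p ∣ F (↥ a) (↧ a) (↥ b) (↧ b) k →
    reduction pr b b0 ∈ CyclicSubgroup (𝔽* p) (reduction pr a a0)
  reduction∈cyclic k p∣F = + k , prime∣*-cancel pr (↧ b * ↧ a ℤ.^ k) _ p∤vs^k
    (subst (+ p ∣_) (identity (↥ a ℤ.^ k) (↧ a ℤ.^ k) (↥ b) (↧ b) v⁻¹ (W k))
      (∣m∣n⇒∣m-n (∣m∣n⇒∣m-n (∣n⇒∣m*n (↧ a ℤ.^ k * ↥ b) vv⁻¹≈1) p∣F)
                 (∣n⇒∣m*n (↧ b) (↧^*-reduction^ k))))
    where
    identity : ∀ R S u v v⁻¹ W →
      S * u * (v * v⁻¹ - 1ℤ) - (R * v - S * u) - v * (S * W - R) ≡ v * S * (u * v⁻¹ - W)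
    identity = solve-∀
    p∤vs^k : ¬ (+ p ∣ ↧ b * ↧ a ℤ.^ k)
    p∤vs^k h = [ (λ p∣v → p∤denominator pr b b0 (∣⇒∣ᵤ p∣v))
               , (λ p∣s^k → p∤denominator pr a a0 (∣⇒∣ᵤ (prime∣^ pr (↧ a) k p∣s^k)))
               ]′ (prime∣* pr (↧ b) (↧ a ℤ.^ k) h)

-- From large primes to infinitely many.

upperBound : ∀ ns → ∃[ N ] All (ℕ._≤ N) ns
upperBound ns = max 0 ns , xs≤max 0 ns

↥-≢0 : ∀ q .{{_ : ℚ.NonZero q}} → ↥ q ≢ 0ℤ
↥-≢0 q eq = ℕ.≢-nonZero⁻¹ ∣ ↥ q ∣ {{numerator-nonZero q}} (cong ∣_∣ eq)

ReducesIntoCyclic : (a b : ℚ) .{{_ : ℚ.NonZero a}} .{{_ : ℚ.NonZero b}} → ℕ → Set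
ReducesIntoCyclic a b p =
  Σ[ pr ∈ Prime p ] Σ[ a0 ∈ ord p a ≡ 0ℤ ] Σ[ b0 ∈ ord p b ≡ 0ℤ ]
    reduction pr b b0 ∈ CyclicSubgroup (𝔽* p) (reduction pr a a0)

-- NonZero instances are explicit from here on: while they are open, conversion
-- checking of reduction unfolds Bézout's algorithm.
∣F⇒reducesIntoCyclic : (a b : ℚ) .{{_ : ℚ.NonZero a}} .{{_ : ℚ.NonZero b}} →
  ∀ {p} k → Prime p → + p ∣ F (↥ a) (↧ a) (↥ b) (↧ b) k →
  ord p a ≡ 0ℤ → ord p b ≡ 0ℤ → ReducesIntoCyclic a b p
∣F⇒reducesIntoCyclic a b {{a≢0}} {{b≢0}} k pr p∣F a0 b0 =
  pr , a0 , b0 , reduction∈cyclic pr a b {{a≢0}} {{b≢0}} a0 b0 k p∣F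

unboundedPrimes : (a b : ℚ) .{{_ : ℚ.NonZero a}} .{{_ : ℚ.NonZero b}} →
  MultiplicativelyIndependent a b → ∀ M → ∃[ p ] ReducesIntoCyclic a b p × M ℕ.< p
unboundedPrimes a b {{a≢0}} {{b≢0}} indep M =
  -- The entry 3 is for `primeDivisor>N`, the numerators and denominators make both orders vanish at
  -- any larger prime, and `M` is the bound to be exceeded.
  fromBound (upperBound (3 ∷ ∣ ↥ a ∣ ∷ ↧ₙ a ∷ ∣ ↥ b ∣ ∷ ↧ₙ b ∷ M ∷ []))
  where
  Goal : Set
  Goal = ∃[ p ] ReducesIntoCyclic a b {{a≢0}} {{b≢0}} p × M ℕ.< p

  fromBound : (∃[ N ] All (ℕ._≤ N) (3 ∷ ∣ ↥ a ∣ ∷ ↧ₙ a ∷ ∣ ↥ b ∣ ∷ ↧ₙ b ∷ M ∷ [])) → Goal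
  fromBound (N , 3≤N ∷ r≤N ∷ s≤N ∷ u≤N ∷ v≤N ∷ M≤N ∷ []) = fromDivisor
    (primeDivisorOfF (↥ a) (↧ a) (↥ b) (↧ b)
      (lowestTerms a) (↥-≢0 a {{a≢0}}) (λ ()) (↥-≢0 b {{b≢0}}) (λ ())
      (independent⇒F≢0 a b {{a≢0}} {{b≢0}} indep) (independent⇒^≢ a b {{a≢0}} {{b≢0}} indep) N 3≤N)
    where
    fromDivisor : (∃[ p ] ∃[ k ] Prime p × + p ∣ F (↥ a) (↧ a) (↥ b) (↧ b) k × N ℕ.< p) → Goal
    fromDivisor (p , k , pr , p∣F , N<p) =
      p ,
      ∣F⇒reducesIntoCyclic a b {{a≢0}} {{b≢0}} k pr p∣F
        (large⇒ord≡0 a {{a≢0}} r≤N s≤N N<p) (large⇒ord≡0 b {{b≢0}} u≤N v≤N N<p) ,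
      ℕₚ.≤-<-trans M≤N N<p

-- A number above the maximum of a list is not in it; the default 0 serves the empty list.
unbounded⇒infinite : (P : ℕ → Set) → (∀ N → ∃[ p ] P p × N ℕ.< p) → Infinite P
unbounded⇒infinite P unbounded xs = avoid (unbounded (max 0 xs))
  where
  avoid : ∃[ p ] P p × max 0 xs ℕ.< p → ∃[ p ] P p × p ∉ xs
  avoid (p , Pp , N<p) = p , Pp , λ p∈xs → ℕₚ.<⇒≱ N<p (lookup (xs≤max 0 xs) p∈xs)

infinitelyManyPrimes : (a b : ℚ) .{{_ : ℚ.NonZero a}} .{{_ : ℚ.NonZero b}} →
  MultiplicativelyIndependent a b → Infinite (ReducesIntoCyclic a b)
infinitelyManyPrimes a b {{a≢0}} {{b≢0}} indep =
  unbounded⇒infinite (ReducesIntoCyclic a b {{a≢0}} {{b≢0}})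
    (unboundedPrimes a b {{a≢0}} {{b≢0}} indep)

theorem1 : (a b : ℚ) .{{_ : ℚ.NonZero a}} .{{_ : ℚ.NonZero b}} →
    MultiplicativelyIndependent a b →
    Infinite (λ p →
    Σ[ pr ∈ Prime p ] Σ[ a0 ∈ ord p a ≡ 0ℤ ] Σ[ b0 ∈ ord p b ≡ 0ℤ ]
    reduction pr b b0 ∈ CyclicSubgroup (𝔽* p) (reduction pr a a0))
theorem1 a b {{a≢0}} {{b≢0}} indep = infinitelyManyPrimes a b {{a≢0}} {{b≢0}} indep
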